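{- Let $G$ be a connected split graph (finite, simple, undirected) with $n \ge 2$ vertices. Then $b(G) \leq 3$. In particular, $b(G) = 3$ only if $\Delta(G) < n-2$, where $\Delta(G)$ is the maximum degree of $G$.
   Context: A split graph is a graph whose vertex set can be partitioned into a clique (a set of mutually adjacent vertices) and an independent set (a set of mutually non-adjacent vertices). One writes $G = (C \cup I, E)$ where $E$ is the edge set, $C$ is a maximal clique and $I = V(G) \setminus C$ is an independent set. Graph burning: initially all vertices of a finite simple undirected graph $G$ are unburned. The process runs in rounds $t = 1, 2, 3, \dots$. In round $t$, a vertex $x_t$ that is not burned at the end of round $t-1$ is chosen as a new source of fire and becomes burned; simultaneously, every vertex adjacent to a vertex that was burned at the end of round $t-1$ becomes burned. Burned vertices remain burned. The process ends at the first round after which all vertices of $G$ are burned. The burning number $b(G)$ is the minimum, over all choices of sources, of the number of rounds needed to burn all vertices of $G$. -}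

module Defs where

open import Level using (0ℓ)
open import Data.Nat.Base using (ℕ; zero; suc; _≤_; z≤n; s≤s)
open import Data.Fin.Base using (Fin)
open import Data.Fin.Properties using (any?; all?; ¬∀⟶∃¬)
open import Data.Fin.Subset using (Subset; _∈_; _∉_; ⊥; ⁅_⁆; ∁; _∪_; _⊃_; ∣_∣)
open import Data.Fin.Subset.Induction using (⊃-wellFounded)
open import Data.Fin.Subset.Properties using (_∈?_; p⊆p∪q; q⊆p∪q; x∈⁅x⁆)
open import Data.List.Base using (map; allFin)
open import Data.List.Extrema.Nat using (max)
open import Data.Product.Base using (∃; _×_; _,_; proj₁)
open import Data.Vec.Base using (tabulate)
open import Function.Base using (_∘_)
open import Induction.WellFounded using (Acc; acc)
open import Relation.Binary.Construct.Closure.ReflexiveTransitive using (Star)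
open import Relation.Binary.Core using (Rel)
open import Relation.Binary.Definitions using (Irreflexive; Symmetric) renaming (Decidable to Decidable₂)
open import Relation.Binary.PropositionalEquality.Core using (_≡_; _≢_)
open import Relation.Nullary.Decidable using (yes; no; does; map′; ¬?; _×-dec_)
open import Relation.Nullary.Negation using (¬_; contradiction)
open import Relation.Unary using (Pred; Decidable)

record Graph (n : ℕ) : Set₁ where
  infix 4 _~_ _~?_
  field
    _~_      : Rel (Fin n) 0ℓ
    _~?_     : Decidable₂ _~_
    ~-sym    : Symmetric _~_
    ~-irrefl : Irreflexive _≡_ _~_

module _ {n : ℕ} (G : Graph n) where
  open Graph G

  Connected : Set
  Connected = ∀ u v → Star _~_ u v

  Clique : Subset n → Set
  Clique S = ∀ {u v} → u ∈ S → v ∈ S → u ≢ v → u ~ v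

  Independent : Subset n → Set
  Independent S = ∀ {u v} → u ∈ S → v ∈ S → ¬ (u ~ v)

  -- Either part may be empty, and the clique is not required to be maximal.
  Split : Set
  Split = ∃ λ (C : Subset n) → Clique C × Independent (∁ C)

  neighbours : Fin n → Subset n
  neighbours v = tabulate λ u → does (v ~? u)

  degree : Fin n → ℕ
  degree v = ∣ neighbours v ∣

  -- The bottom value 0 only matters for the graph with no vertices.
  Δ : ℕ
  Δ = max 0 (map degree (allFin n))

  spread : Subset n → Subset n
  spread B = tabulate λ v → does (any? λ u → (u ∈? B) ×-dec (u ~? v))

  -- The set burned after a round with source x, if B was burned before it.
  -- Only vertices of B spread the fire in this round; x does not.
  burnRound : Subset n → Fin n → Subset n
  burnRound B x = ⁅ x ⁆ ∪ (B ∪ spread B)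

  -- BurnsIn B k: from burned set B, some legal choice of sources makes the
  -- process end after exactly k further rounds.  A source may be a vertex that
  -- the fire reaches in the same round; it only has to be unburned before it.
  data BurnsIn (B : Subset n) : ℕ → Set where
    done  : (∀ v → v ∈ B) → BurnsIn B 0
    round : ∀ {k} (x : Fin n) → x ∉ B → BurnsIn (burnRound B x) k → BurnsIn B (suc k)

  IsBurningNumber : ℕ → Set
  IsBurningNumber b = BurnsIn ⊥ b × (∀ k → BurnsIn ⊥ k → b ≤ k)

  burnsIn? : ∀ B → Decidable (BurnsIn B)
  burnsIn? B zero    = map′ done (λ { (done f) → f }) (all? (_∈? B))
  burnsIn? B (suc k) =
    map′ (λ { (x , x∉B , p) → round x x∉B p }) (λ { (round x x∉B p) → x , x∉B , p })
         (any? λ x → ¬? (x ∈? B) ×-dec burnsIn? (burnRound B x) k)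

  burns : ∀ B → ∃ (BurnsIn B)
  burns B = go B (⊃-wellFounded B)
    where
    go : ∀ B → Acc _⊃_ B → ∃ (BurnsIn B)
    go B (acc rec) with all? (_∈? B)
    ... | yes all∈B = 0 , done all∈B
    ... | no ¬all∈B =
      let x , x∉B = ¬∀⟶∃¬ n (_∈ B) (_∈? B) ¬all∈B
          B⊂B′ : burnRound B x ⊃ B
          B⊂B′ = (λ z → q⊆p∪q ⁅ x ⁆ _ (p⊆p∪q (spread B) z))
               , x , p⊆p∪q (B ∪ spread B) (x∈⁅x⁆ x) , x∉B
          k , p = go (burnRound B x) (rec B⊂B′)
      in suc k , round x x∉B p

least : ∀ {P : Pred ℕ 0ℓ} → Decidable P → ∃ P → ∃ λ b → P b × (∀ k → P k → b ≤ k)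
least P? (m , pm) = go P? m pm
  where
  go : ∀ {P : Pred ℕ 0ℓ} → Decidable P → ∀ m → P m → ∃ λ b → P b × (∀ k → P k → b ≤ k)
  go P? zero    p = zero , p , λ _ _ → z≤n
  go P? (suc m) p with P? zero
  ... | yes p₀ = zero , p₀ , λ _ _ → z≤n
  ... | no ¬p₀ =
    let b , pb , minimal = go (P? ∘ suc) m p
    in suc b , pb , λ { zero p₀ → contradiction p₀ ¬p₀ ; (suc k) pk → s≤s (minimal k pk) }

burningNumber : ∀ {n} (G : Graph n) → ∃ (IsBurningNumber G)
burningNumber G = least (burnsIn? G ⊥) (burns G ⊥)

b : ∀ {n} → Graph n → ℕ
b G = proj₁ (burningNumber G)

{-# OPTIONS --safe #-}
-- A first source in the clique burns the whole clique by the end of round 2,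
-- and every vertex outside the clique has a neighbour in it, so round 3
-- finishes.  If instead some vertex v has degree at least n − 2, then starting
-- at v leaves at most one vertex outside the closed neighbourhood of v, and
-- choosing that vertex as the second source finishes in round 2.
module Submission where

open import Defs
open import Data.Bool.Base using (true)
open import Data.Nat.Base using (ℕ; suc; _≤_; _<_; _∸_; _+_; z≤n; s≤s)
open import Data.Nat.Properties
  using (≤-trans; ≤-<-trans; ≰⇒>; <⇒≱; 1+n≰n; +-comm; +-monoʳ-≤; m≤n+m∸n; m≤n+o⇒m∸n≤o; module ≤-Reasoning)
open import Data.Fin.Base using (Fin; zero; suc)
open import Data.Fin.Properties using (_≟_; any?; all?; ¬∀⟶∃¬)
open import Data.Fin.Subset using (Subset; _∈_; _∉_; ⊥; ∁; _-_; ∣_∣; ⁅_⁆)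
open import Data.Fin.Subset.Properties
  using (_∈?_; ∉⊥; x∈⁅x⁆; x∈⁅y⁆⇒x≡y; x∈p∪q⁺; x∈p∪q⁻; x∉p⇒x∈∁p; ∣∁p∣≡n∸∣p∣; x∈p⇒∣p-x∣<∣p∣; x∈p∧x≢y⇒x∈p-y)
open import Data.List.Base using (allFin)
open import Data.List.Extrema.Nat using (max<v⁺)
open import Data.List.Relation.Unary.All using (universal)
open import Data.List.Relation.Unary.All.Properties using (map⁺)
open import Data.Product.Base using (∃; _×_; _,_; proj₁; proj₂)
open import Data.Sum.Base using (inj₁; inj₂)
open import Data.Vec.Base using (tabulate)
open import Data.Vec.Properties using (lookup∘tabulate; []=⇒lookup; lookup⇒[]=)
open import Level using (0ℓ)
open import Relation.Binary.Construct.Closure.ReflexiveTransitive using (ε; _◅_)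
open import Relation.Binary.PropositionalEquality.Core using (_≡_; _≢_; refl; sym; trans; subst)
open import Relation.Nullary.Decidable using (yes; no; does; proof; dec-true; decidable-stable; ¬?; _×-dec_)
open import Relation.Nullary.Negation using (¬_; contradiction)
open import Relation.Nullary.Reflects using (Reflects; invert)
open import Relation.Unary using (Pred; Decidable)

module _ {n : ℕ} {P : Pred (Fin n) 0ℓ} (P? : Decidable P) where

  ∈-tabulate-does⁺ : ∀ {v} → P v → v ∈ tabulate (λ u → does (P? u))
  ∈-tabulate-does⁺ {v} p = lookup⇒[]= v _ (trans (lookup∘tabulate _ v) (dec-true (P? v) p))

  ∈-tabulate-does⁻ : ∀ {v} → v ∈ tabulate (λ u → does (P? u)) → P v
  ∈-tabulate-does⁻ {v} v∈ = invert (subst (Reflects (P v)) does≡true (proof (P? v)))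
    where
    does≡true : does (P? v) ≡ true
    does≡true = trans (sym (lookup∘tabulate _ v)) ([]=⇒lookup v∈)

∣p-x∣≥m⇒∣p∣>m : ∀ {n m x} {p : Subset n} → x ∈ p → m ≤ ∣ p - x ∣ → m < ∣ p ∣
∣p-x∣≥m⇒∣p∣>m x∈p m≤ = ≤-<-trans m≤ (x∈p⇒∣p-x∣<∣p∣ x∈p)

-- Deleting `x`, `y` and `z` in turn lowers the size strictly each time, since distinctness keeps
-- the later points in the set until their turn.
three-distinct⇒3≤∣p∣ : ∀ {n x y z} {p : Subset n} → x ∈ p → y ∈ p → z ∈ p →
                       y ≢ x → z ≢ x → z ≢ y → 3 ≤ ∣ p ∣
three-distinct⇒3≤∣p∣ x∈p y∈p z∈p y≢x z≢x z≢y =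
  ∣p-x∣≥m⇒∣p∣>m x∈p
    (∣p-x∣≥m⇒∣p∣>m (x∈p∧x≢y⇒x∈p-y y∈p y≢x)
      (∣p-x∣≥m⇒∣p∣>m (x∈p∧x≢y⇒x∈p-y (x∈p∧x≢y⇒x∈p-y z∈p z≢x) z≢y) z≤n))

another : ∀ {n} → 2 ≤ n → (v : Fin n) → ∃ (v ≢_)
another (s≤s (s≤s _)) zero    = suc zero , λ ()
another (s≤s (s≤s _)) (suc _) = zero , λ ()

module _ {n : ℕ} (G : Graph n) where
  open Graph G

  source∈burnRound : ∀ B x → x ∈ burnRound G B x
  source∈burnRound B x = x∈p∪q⁺ (inj₁ (x∈⁅x⁆ x))

  burned∈burnRound : ∀ {B v} x → v ∈ B → v ∈ burnRound G B x
  burned∈burnRound x v∈B = x∈p∪q⁺ (inj₂ (x∈p∪q⁺ (inj₁ v∈B)))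

  neighbour∈burnRound : ∀ {B u v} x → u ∈ B → u ~ v → v ∈ burnRound G B x
  neighbour∈burnRound {B} x u∈B u~v =
    x∈p∪q⁺ (inj₂ (x∈p∪q⁺ (inj₂
      (∈-tabulate-does⁺ (λ v → any? λ u → (u ∈? B) ×-dec (u ~? v)) (_ , u∈B , u~v)))))

  -- Nothing burns before the first round, so no fire spreads in it. This makes any vertex other
  -- than the first source legal as the second one.
  burnRound-⊥⁻ : ∀ {x v} → v ∈ burnRound G ⊥ x → v ≡ x
  burnRound-⊥⁻ {x} v∈ with x∈p∪q⁻ ⁅ x ⁆ _ v∈
  ... | inj₁ v∈⁅x⁆ = x∈⁅y⁆⇒x≡y x v∈⁅x⁆
  ... | inj₂ v∈′ with x∈p∪q⁻ ⊥ (spread G ⊥) v∈′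
  ...   | inj₁ v∈⊥ = contradiction v∈⊥ ∉⊥
  ...   | inj₂ v∈spread
          with ∈-tabulate-does⁻ (λ v → any? λ u → (u ∈? ⊥) ×-dec (u ~? v)) v∈spread
  ...     | _ , u∈⊥ , _ = contradiction u∈⊥ ∉⊥

  -- `BurnsIn` counts rounds exactly, and no legal source is left once everything burns. An upper
  -- bound lets a strategy ignore whether the process stops early.
  BurnsWithin : Subset n → ℕ → Set
  BurnsWithin B m = ∃ λ k → k ≤ m × BurnsIn G B k

  burnsWithin-done : ∀ {B m} → (∀ v → v ∈ B) → BurnsWithin B m
  burnsWithin-done all∈B = 0 , z≤n , done all∈B

  burnsWithin-round : ∀ {B m} x → x ∉ B → BurnsWithin (burnRound G B x) m → BurnsWithin B (suc m)
  burnsWithin-round x x∉B (k , k≤m , p) = suc k , s≤s k≤m , round x x∉B p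

  -- For rounds whose source is irrelevant: either the process is already over, or some unburned
  -- vertex can serve as source.
  burnsWithin-anyRound : ∀ {B m} → (∀ x → BurnsWithin (burnRound G B x) m) → BurnsWithin B (suc m)
  burnsWithin-anyRound {B} next with all? (_∈? B)
  ... | yes all∈B = burnsWithin-done all∈B
  ... | no ¬all∈B =
    let x , x∉B = ¬∀⟶∃¬ n (_∈ B) (_∈? B) ¬all∈B in burnsWithin-round x x∉B (next x)

  burnsWithin⇒b≤ : ∀ {m} → BurnsWithin ⊥ m → b G ≤ m
  burnsWithin⇒b≤ (k , k≤m , p) = ≤-trans (proj₂ (proj₂ (burningNumber G)) k p) k≤m

  connected⇒neighbour : 2 ≤ n → Connected G → ∀ v → ∃ (v ~_)
  connected⇒neighbour 2≤n conn v with another 2≤n v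
  ... | w , v≢w with conn v w
  ...   | ε         = contradiction refl v≢w
  ...   | v~u ◅ _   = _ , v~u

  -- Connectedness gives `v` some neighbour, and independence of `∁ C` forces that neighbour into
  -- `C`.
  split⇒cliqueNeighbour : 2 ≤ n → Connected G → ∀ {C} → Independent G (∁ C) →
                          ∀ {v} → v ∉ C → ∃ λ u → u ∈ C × v ~ u
  split⇒cliqueNeighbour 2≤n conn {C} ind {v} v∉C with connected⇒neighbour 2≤n conn v
  ... | u , v~u with u ∈? C
  ...   | yes u∈C = u , u∈C , v~u
  ...   | no  u∉C = contradiction v~u (ind (x∉p⇒x∈∁p v∉C) (x∉p⇒x∈∁p u∉C))

  split⇒b≤3 : 2 ≤ n → Connected G → Split G → b G ≤ 3
  split⇒b≤3 2≤n@(s≤s _) conn (C , clique , ind) =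
    burnsWithin⇒b≤
      (burnsWithin-round c ∉⊥
        (burnsWithin-anyRound λ x → burnsWithin-anyRound λ y → burnsWithin-done (burned x y)))
    where
    toClique : ∀ {v} → v ∉ C → ∃ λ u → u ∈ C × v ~ u
    toClique = split⇒cliqueNeighbour 2≤n conn ind

    -- `Split` allows an empty `C`; here a vertex outside `C` would still have a neighbour in it.
    clique-nonempty : ∃ (_∈ C)
    clique-nonempty with zero ∈? C
    ... | yes 0∈C = zero , 0∈C
    ... | no  0∉C = let u , u∈C , _ = toClique 0∉C in u , u∈C

    c   = proj₁ clique-nonempty
    c∈C = proj₂ clique-nonempty

    B₁ = burnRound G ⊥ c

    -- `c` burns at the end of round 1, so it ignites its neighbours in round 2 whatever the second
    -- source `x` is.
    clique-burned : ∀ x {u} → u ∈ C → u ∈ burnRound G B₁ x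
    clique-burned x {u} u∈C with c ≟ u
    ... | yes refl = burned∈burnRound x (source∈burnRound ⊥ c)
    ... | no  c≢u  = neighbour∈burnRound x (source∈burnRound ⊥ c) (clique c∈C u∈C c≢u)

    burned : ∀ x y v → v ∈ burnRound G (burnRound G B₁ x) y
    burned x y v with v ∈? C
    ... | yes v∈C = burned∈burnRound y (clique-burned x v∈C)
    ... | no  v∉C = let u , u∈C , v~u = toClique v∉C in
                    neighbour∈burnRound y (clique-burned x u∈C) (~-sym v~u)

  -- The complement of `neighbours G v` has at least 3 elements, whereas `n ∸ 2 ≤ degree G v` would
  -- leave it at most 2.
  three-nonNeighbours⇒degree< : ∀ {v x y z} → ¬ (v ~ x) → ¬ (v ~ y) → ¬ (v ~ z) →
                                y ≢ x → z ≢ x → z ≢ y → degree G v < n ∸ 2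
  three-nonNeighbours⇒degree< {v} v≁x v≁y v≁z y≢x z≢x z≢y = ≰⇒> λ n∸2≤d → 1+n≰n (begin
    3                       ≤⟨ three-distinct⇒3≤∣p∣ (nonNeighbour v≁x) (nonNeighbour v≁y)
                                                    (nonNeighbour v≁z) y≢x z≢x z≢y ⟩
    ∣ ∁ (neighbours G v) ∣  ≡⟨ ∣∁p∣≡n∸∣p∣ (neighbours G v) ⟩
    n ∸ degree G v          ≤⟨ m≤n+o⇒m∸n≤o n (degree G v) (n≤degree+2 n∸2≤d) ⟩
    2                       ∎)
    where
    open ≤-Reasoning

    n≤degree+2 : n ∸ 2 ≤ degree G v → n ≤ degree G v + 2
    n≤degree+2 n∸2≤d = begin
      -- Truncation is harmless here: `n ≤ 2 + (n ∸ 2)` holds even for `n < 2`.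
      n               ≤⟨ m≤n+m∸n n 2 ⟩
      2 + (n ∸ 2)     ≤⟨ +-monoʳ-≤ 2 n∸2≤d ⟩
      2 + degree G v  ≡⟨ +-comm 2 (degree G v) ⟩
      degree G v + 2  ∎

    nonNeighbour : ∀ {u} → ¬ (v ~ u) → u ∈ ∁ (neighbours G v)
    nonNeighbour v≁u = x∉p⇒x∈∁p λ u∈N → v≁u (∈-tabulate-does⁻ (v ~?_) u∈N)

  n∸2≤degree⇒b≤2 : ∀ v → n ∸ 2 ≤ degree G v → b G ≤ 2
  n∸2≤degree⇒b≤2 v n∸2≤d = burnsWithin⇒b≤ (burnsWithin-round v ∉⊥ secondRound)
    where
    B₁ = burnRound G ⊥ v

    closedNeighbour-burned : ∀ x u → (u ≢ v → v ~ u) → u ∈ burnRound G B₁ x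
    closedNeighbour-burned x u adj with u ≟ v
    ... | yes refl = burned∈burnRound x (source∈burnRound ⊥ v)
    ... | no  u≢v  = neighbour∈burnRound x (source∈burnRound ⊥ v) (adj u≢v)

    v≁v : ¬ (v ~ v)
    v≁v = ~-irrefl refl

    secondRound : BurnsWithin B₁ 1
    secondRound with any? (λ x → ¬? (x ≟ v) ×-dec ¬? (v ~? x))
    ... | yes (x , x≢v , v≁x) =
      burnsWithin-round x (λ x∈B₁ → x≢v (burnRound-⊥⁻ x∈B₁)) (burnsWithin-done burned)
      where
      burned : ∀ u → u ∈ burnRound G B₁ x
      burned u with u ≟ x
      ... | yes refl = source∈burnRound B₁ x
      ... | no  u≢x  = closedNeighbour-burned x u λ u≢v → decidable-stable (v ~? u) λ v≁u →
        -- The three non-neighbours are `v` itself, the second source `x`, and the supposedly missed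
        -- vertex `u`.
        <⇒≱ (three-nonNeighbours⇒degree< v≁v v≁x v≁u x≢v u≢v u≢x) n∸2≤d
    ... | no none =
      -- Here `v` is adjacent to every other vertex, so the second source does not matter.
      burnsWithin-anyRound λ x → burnsWithin-done λ u →
        closedNeighbour-burned x u λ u≢v → decidable-stable (v ~? u) λ v≁u → none (u , u≢v , v≁u)

  degrees<⇒Δ< : ∀ {m} → 0 < m → (∀ v → degree G v < m) → Δ G < m
  degrees<⇒Δ< 0<m degree<m = max<v⁺ 0<m (map⁺ (universal degree<m (allFin n)))

  b≰2⇒Δ<n∸2 : 2 ≤ n → ¬ (b G ≤ 2) → Δ G < n ∸ 2
  -- The maximum starts from the default 0, so `0 < n ∸ 2` is required too; it follows from the
  -- degree bound at the vertex `zero`.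
  b≰2⇒Δ<n∸2 (s≤s _) b≰2 = degrees<⇒Δ< (≤-<-trans z≤n (degree< zero)) degree<
    where
    degree< : ∀ v → degree G v < n ∸ 2
    degree< v = ≰⇒> λ n∸2≤d → b≰2 (n∸2≤degree⇒b≤2 v n∸2≤d)

theorem3p2 : (n : ℕ) → 2 ≤ n → (G : Graph n) → Connected G → Split G →
    b G ≤ 3 × (b G ≡ 3 → Δ G < n ∸ 2)
theorem3p2 n 2≤n G conn split =
  split⇒b≤3 G 2≤n conn split ,
  λ b≡3 → b≰2⇒Δ<n∸2 G 2≤n λ b≤2 → 1+n≰n (subst (_≤ 2) b≡3 b≤2)
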